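{- If $G$ is a connected graph of order $n$, then $$b(G)\leq \left\lceil\frac{ -3+\sqrt{24n+33}}{4}\right\rceil,$$ where $b(G)$ denotes the burning number of $G$.
   Context: Burning process on a finite graph $G$: initially all vertices are unburned. In each round, every already burned vertex spreads fire to all of its neighbors, which become burned, and at the same time one chooses an unburned vertex (if any remains) and changes its status to burned; burned vertices remain burned. The burning number $b(G)$ is the minimum number of rounds needed to burn all vertices of $G$. The order of $G$ is its number of vertices. -}

module Defs where

open import Data.Fin.Base using (Fin)
open import Data.Fin.Properties using (any?; all?; ¬∀⟶∃¬)
open import Data.Fin.Subset using (Subset; ⊥; ⁅_⁆; _∪_; _∈_; _∉_; ∣_∣)
open import Data.Fin.Subset.Properties using (_∈?_; ∈⊤; p⊂q⇒∣p∣<∣q∣; p⊆p∪q; q⊆p∪q; x∈⁅x⁆; ∣p∣≡n⇒p≡⊤; ∣p∣≤n)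
open import Data.Integer.Base as ℤ using (ℤ; +_)
open import Data.Nat.Base as ℕ using (ℕ; zero; suc; NonZero)
import Data.Nat.Properties as ℕ
open import Data.Product using (∃; ∃-syntax; _×_; _,_; proj₁)
open import Data.Rational.Unnormalised.Base as ℚᵘ using (ℚᵘ; 0ℚᵘ; _/_)
open import Data.Sum using (_⊎_; inj₁; inj₂)
open import Data.Vec.Base using (tabulate)
open import Function using (_∘_)
open import Level using (0ℓ)
open import Relation.Binary.Construct.Closure.ReflexiveTransitive using (Star)
open import Relation.Binary.Core using (Rel)
open import Relation.Binary.Definitions using (Decidable; Irreflexive; Symmetric)
open import Relation.Binary.PropositionalEquality using (_≡_; subst; sym)
open import Relation.Nullary using (Dec; yes; no; does; contradiction)
open import Relation.Nullary.Decidable using (map′; _×-dec_; _⊎-dec_; ¬?)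
open import Relation.Unary as Unary using (Pred)

record Graph (n : ℕ) : Set₁ where
  infix 4 _~_ _~?_
  field
    _~_      : Rel (Fin n) 0ℓ
    _~?_     : Decidable _~_
    ~-sym    : Symmetric _~_
    ~-irrefl : Irreflexive _≡_ _~_

Connected : ∀ {n} → Graph n → Set
Connected G = ∀ u v → Star _~_ u v
  where open Graph G

least : (P : Pred ℕ 0ℓ) → Unary.Decidable P → ∀ m → P m → ∃[ k ] P k × (∀ j → P j → k ℕ.≤ j)
least P P? zero    p = zero , p , λ _ _ → ℕ.z≤n
least P P? (suc m) p with P? zero
... | yes p₀ = zero , p₀ , λ _ _ → ℕ.z≤n
... | no ¬p₀ with least (P ∘ suc) (P? ∘ suc) m p
...   | k , q , min = suc k , q , λ where
  zero    p₀ → contradiction p₀ ¬p₀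
  (suc j) pj → ℕ.s≤s (min j pj)

-- In the burning process a subset is the set of burned vertices.
module Burning {n} (G : Graph n) where
  open Graph G

  neighbours : Subset n → Subset n
  neighbours S = tabulate λ v → does (any? λ u → (u ∈? S) ×-dec (u ~? v))

  spread : Subset n → Subset n
  spread S = S ∪ neighbours S

  -- The new fire and the spreading happen simultaneously, so the chosen
  -- vertex only has to be unburned at the beginning of the round.
  data Round (S : Subset n) : Subset n → Set where
    ignite  : ∀ x → x ∉ S → Round S (spread S ∪ ⁅ x ⁆)
    nothing : (∀ x → x ∈ S) → Round S (spread S)

  data Rounds : ℕ → Subset n → Subset n → Set where
    []  : ∀ {S} → Rounds zero S S
    _∷_ : ∀ {k S T U} → Round S T → Rounds k T U → Rounds (suc k) S U

  BurnsFrom : Subset n → ℕ → Set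
  BurnsFrom S k = ∃[ T ] Rounds k S T × (∀ v → v ∈ T)

  BurnsIn : ℕ → Set
  BurnsIn = BurnsFrom ⊥

  burnsFrom? : ∀ S k → Dec (BurnsFrom S k)
  burnsFrom? S zero =
    map′ (λ full → S , [] , full) (λ where (_ , [] , full) → full) (all? (_∈? S))
  burnsFrom? S (suc k) = map′ to from
    (any? (λ x → ¬? (x ∈? S) ×-dec burnsFrom? (spread S ∪ ⁅ x ⁆) k)
      ⊎-dec (all? (_∈? S) ×-dec burnsFrom? (spread S) k))
    where
    First : Set
    First = (∃[ x ] x ∉ S × BurnsFrom (spread S ∪ ⁅ x ⁆) k)
              ⊎ ((∀ x → x ∈ S) × BurnsFrom (spread S) k)

    to : First → BurnsFrom S (suc k)
    to (inj₁ (x , x∉S , T , rs , full)) = T , ignite x x∉S ∷ rs , full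
    to (inj₂ (all , T , rs , full))     = T , nothing all ∷ rs , full

    from : BurnsFrom S (suc k) → First
    from (T , ignite x x∉S ∷ rs , full) = inj₁ (x , x∉S , T , rs , full)
    from (T , nothing all ∷ rs , full)  = inj₂ (all , T , rs , full)

  burnsEventually : ∀ m S → n ℕ.≤ m ℕ.+ ∣ S ∣ → ∃ (BurnsFrom S)
  burnsEventually m S n≤ with all? (_∈? S)
  ... | yes full = zero , S , [] , full
  burnsEventually zero S n≤ | no ¬full =
    contradiction (λ x → subst (x ∈_) (sym (∣p∣≡n⇒p≡⊤ (ℕ.≤-antisym (∣p∣≤n S) n≤))) ∈⊤) ¬full
  burnsEventually (suc m) S n≤ | no ¬full with ¬∀⟶∃¬ n (_∈ S) (_∈? S) ¬full
  ... | x , x∉S with burnsEventually m S′ n≤′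
    where
    S′ : Subset n
    S′ = spread S ∪ ⁅ x ⁆

    ∣S∣<∣S′∣ : ∣ S ∣ ℕ.< ∣ S′ ∣
    ∣S∣<∣S′∣ = p⊂q⇒∣p∣<∣q∣
      ( (λ y∈S → p⊆p∪q ⁅ x ⁆ (p⊆p∪q (neighbours S) y∈S))
      , x , q⊆p∪q (spread S) ⁅ x ⁆ (x∈⁅x⁆ x) , x∉S )

    n≤′ : n ℕ.≤ m ℕ.+ ∣ S′ ∣
    n≤′ = ℕ.≤-trans n≤ (ℕ.≤-trans (ℕ.≤-reflexive (sym (ℕ.+-suc m ∣ S ∣))) (ℕ.+-monoʳ-≤ m ∣S∣<∣S′∣))
  ...   | k , T , rs , full = suc k , T , ignite x x∉S ∷ rs , full

  minimumRounds : ∃[ b ] BurnsIn b × (∀ k → BurnsIn k → b ℕ.≤ k)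
  minimumRounds with burnsEventually n ⊥ (ℕ.m≤m+n n _)
  ... | m , burns = least BurnsIn (burnsFrom? ⊥) m burns

burningNumber : ∀ {n} → Graph n → ℕ
burningNumber G = proj₁ (Burning.minimumRounds G)

-- A real number x is represented by its closed upper cut { q ∈ ℚ ∣ x ≤ q }.
UpperCut : Set₁
UpperCut = Pred ℚᵘ 0ℓ

infix  9 √_
infixl 7 _÷_
infixr 6 _⊕_

√_ : ℕ → UpperCut
(√ m) q = 0ℚᵘ ℚᵘ.≤ q × (+ m / 1) ℚᵘ.≤ q ℚᵘ.* q

-- a + x ≤ q  iff  x ≤ q - a
_⊕_ : ℤ → UpperCut → UpperCut
(a ⊕ x) q = x (q ℚᵘ.- a / 1)

-- x / d ≤ q  iff  x ≤ q d
_÷_ : UpperCut → (d : ℕ) .{{_ : NonZero d}} → UpperCut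
(x ÷ d) q = x (q ℚᵘ.* (+ d / 1))

_IsCeilingOf_ : ℤ → UpperCut → Set
k IsCeilingOf x = x (k / 1) × (∀ j → x (j / 1) → k ℤ.≤ j)

{-# OPTIONS --safe #-}

-- It suffices to cover a spanning tree by balls of radii 0, …, k - 1 when
-- 3 n + 3 ≤ k (2 k + 3). Walk down from the root to a deepest vertex p₀. The ball
-- of radius r around the r-th vertex above p₀ contains a whole subtree, which can
-- be cut off; it is stopped only by a side branch so deep that every larger ball
-- swallowing this branch gains 2 r + 2 vertices. Split the radii at a ≈ k / 2.
-- Among the radii a, …, M, the smallest one that gains M + 2 vertices also gains
-- 2 s + 2 for every smaller s, and this suffices for the upper half to gain
-- (k - a) (k + 1) vertices in total. If no ball gains M + 2, the tree is so close to
-- a path that the largest radius x < a gains almost 2 x + 1 vertices, more than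
-- its share. What is left is covered by the lower half, by induction on k.
module Submission where

open import Defs

module TreeGains where

  open import Data.Fin.Base using (Fin)
  open import Data.List.Base using (List; []; _∷_; _++_)
  open import Data.List.Relation.Binary.Pointwise using (Pointwise; []; _∷_)
  open import Data.Nat.Base using (ℕ; zero; suc; _+_; _*_; _≤_; _<_; z≤n; s≤s; _⊔_)
  open import Data.Nat.Properties
  open import Data.Nat.Tactic.RingSolver using (solve-∀)
  open import Data.Product using (∃-syntax; Σ-syntax; _×_; _,_; proj₁; proj₂)
  open import Data.Sum using (_⊎_; inj₁; inj₂; map₁; map₂)
  open import Data.Unit.Base using (⊤; tt)
  open import Level using (0ℓ)
  open import Relation.Binary.PropositionalEquality using (_≡_; refl; sym; trans; cong)
  open import Relation.Nullary using (¬_; yes; no; contradiction)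
  open import Relation.Unary using (Pred)

  -- A linear inequality follows from a ≤ b by cancelling b on both sides.
  linear : ∀ {p q} c {a b} → a ≤ b → p + b + c ≡ q + a → p ≤ q
  linear {p} {q} c {a} {b} a≤b eq = +-cancelʳ-≤ b p q (begin
    p + b      ≤⟨ m≤m+n (p + b) c ⟩
    p + b + c  ≡⟨ eq ⟩
    q + a      ≤⟨ +-monoʳ-≤ q a≤b ⟩
    q + b      ∎)
    where open ≤-Reasoning

  module Trees {n} (G : Graph n) where
    open Graph G

    data Within : ℕ → Fin n → Fin n → Set where
      here : ∀ {r v} → Within r v v
      step : ∀ {r u w v} → u ~ w → Within r w v → Within (suc r) u v

    within-mono : ∀ {r r′ u v} → r ≤ r′ → Within r u v → Within r′ u v
    within-mono r≤r′       here        = here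
    within-mono (s≤s r≤r′) (step e wn) = step e (within-mono r≤r′ wn)

    within-trans : ∀ {r r′ u v w} → Within r u v → Within r′ v w → Within (r + r′) u w
    within-trans {r} {r′} here wn    = within-mono (m≤n+m r′ r) wn
    within-trans (step e wn) wn′ = step e (within-trans wn wn′)

    within-snoc : ∀ {r u v w} → Within r u v → v ~ w → Within (suc r) u w
    within-snoc here        e  = step e here
    within-snoc (step f wn) e  = step f (within-snoc wn e)

    data Cover : List ℕ → Pred (Fin n) 0ℓ → Set₁ where
      done : ∀ {L P} → (∀ x → ¬ P x) → Cover L P
      ball : ∀ {r L P Q} c → (∀ {x} → P x → Within r c x ⊎ Q x) → Cover L Q → Cover (r ∷ L) P

    cover-mono : ∀ {L L′ P} → Pointwise _≤_ L L′ → Cover L P → Cover L′ P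
    cover-mono _           (done empty)   = done empty
    cover-mono (r≤r′ ∷ pw) (ball c f cov) = ball c
      (λ p → map₁ (within-mono r≤r′) (f p)) (cover-mono pw cov)

    cover-insert : ∀ us {r vs P Q} c → (∀ {x} → P x → Within r c x ⊎ Q x) →
                   Cover (us ++ vs) Q → Cover (us ++ r ∷ vs) P
    cover-insert []       c f cov          = ball c f cov
    cover-insert (u ∷ us) c f (done empty) = ball c inj₂ (cover-insert us c f (done empty))
    cover-insert (u ∷ us) {r} {P = P} c f (ball {Q = Z} c′ f′ cov) =
      ball {Q = λ x → Within r c x ⊎ Z x} c′ split (cover-insert us c (λ z → z) cov)
      where
      split : ∀ {x} → P x → Within u c′ x ⊎ (Within r c x ⊎ Z x)
      split p with f p
      ... | inj₁ wn = inj₂ (inj₁ wn)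
      ... | inj₂ q with f′ q
      ...   | inj₁ wn = inj₁ wn
      ...   | inj₂ z  = inj₂ (inj₂ z)

    data Tree : Fin n → Set where
      leaf  : ∀ v → Tree v
      graft : ∀ {v u} → v ~ u → Tree v → Tree u → Tree v

    data _∈ᵗ_ (x : Fin n) : ∀ {v} → Tree v → Set where
      root  : x ∈ᵗ leaf x
      left  : ∀ {v u} {e : v ~ u} {s t} → x ∈ᵗ s → x ∈ᵗ graft e s t
      right : ∀ {v u} {e : v ~ u} {s t} → x ∈ᵗ t → x ∈ᵗ graft e s t

    size : ∀ {v} → Tree v → ℕ
    size (leaf v)      = 1
    size (graft e s t) = size s + size t

    height : ∀ {v} → Tree v → ℕ
    height (leaf v)      = 0
    height (graft e s t) = height s ⊔ suc (height t)

    height<size : ∀ {v} (t : Tree v) → height t < size t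
    height<size (leaf v)      = s≤s z≤n
    height<size (graft e s t) = ⊔-lub
      (≤-trans (height<size s) (m≤m+n _ _))
      (+-mono-≤ (≤-trans (s≤s z≤n) (height<size s)) (height<size t))

    within-height : ∀ {v x} (t : Tree v) → x ∈ᵗ t → Within (height t) v x
    within-height (leaf v)      root        = here
    within-height (graft e s t) (left x∈s)  = within-mono (m≤m⊔n _ _) (within-height s x∈s)
    within-height (graft e s t) (right x∈t) =
      within-mono (m≤n⊔m (height s) _) (step e (within-height t x∈t))

    -- A path p₀, …, p_h ending at the root, together with a tree of height at
    -- most j attached to p_j for every j; p₀ is then a deepest vertex.
    data Spine : ℕ → Fin n → Set where
      base : ∀ {v} (s : Tree v) → height s ≤ 0 → Spine 0 v
      ext  : ∀ {h v u} → v ~ u → (s : Tree v) → height s ≤ suc h → Spine h u → Spine (suc h) v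

    data _∈ˢ_ (x : Fin n) : ∀ {h v} → Spine h v → Set where
      base : ∀ {v} {s : Tree v} {b} → x ∈ᵗ s → x ∈ˢ base s b
      top  : ∀ {h v u} {e : v ~ u} {s b} {p : Spine h u} → x ∈ᵗ s → x ∈ˢ ext e s b p
      down : ∀ {h v u} {e : v ~ u} {s b} {p : Spine h u} → x ∈ˢ p → x ∈ˢ ext e s b p

    sizeˢ : ∀ {h v} → Spine h v → ℕ
    sizeˢ (base s _)    = size s
    sizeˢ (ext _ s _ p) = size s + sizeˢ p

    height<sizeˢ : ∀ {h v} (p : Spine h v) → h < sizeˢ p
    height<sizeˢ (base s _)    = ≤-trans (s≤s z≤n) (height<size s)
    height<sizeˢ (ext _ s _ p) = +-mono-≤ (≤-trans (s≤s z≤n) (height<size s)) (height<sizeˢ p)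

    record SpineOf {v} (t : Tree v) : Set where
      field
        {h}    : ℕ
        spine  : Spine h v
        high   : height t ≤ h
        size≡  : sizeˢ spine ≡ size t
        covers : ∀ {x} → x ∈ᵗ t → x ∈ˢ spine

    graftTop : ∀ {h v u} → v ~ u → (t : Tree u) → height t < h → Spine h v → Spine h v
    graftTop e t b (ext f s c p) = ext f (graft e s t) (⊔-lub c b) p

    sizeˢ-graftTop : ∀ {h v u} (e : v ~ u) t (b : height t < h) (p : Spine h v) →
                     sizeˢ (graftTop e t b p) ≡ sizeˢ p + size t
    sizeˢ-graftTop e t b (ext f s c p) = lemma (size s) (size t) (sizeˢ p)
      where
      lemma : ∀ x y z → x + y + z ≡ x + z + y
      lemma = solve-∀

    ∈-graftTopˡ : ∀ {x h v u} (e : v ~ u) t (b : height t < h) (p : Spine h v) →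
                  x ∈ˢ p → x ∈ˢ graftTop e t b p
    ∈-graftTopˡ e t b (ext f s c p) (top x∈)  = top (left x∈)
    ∈-graftTopˡ e t b (ext f s c p) (down x∈) = down x∈

    ∈-graftTopʳ : ∀ {x h v u} (e : v ~ u) t (b : height t < h) (p : Spine h v) →
                  x ∈ᵗ t → x ∈ˢ graftTop e t b p
    ∈-graftTopʳ e t b (ext f s c p) x∈ = top (right x∈)

    spineOf : ∀ {v} (t : Tree v) → SpineOf t
    spineOf (leaf v) = record
      { spine = base (leaf v) z≤n ; high = z≤n ; size≡ = refl ; covers = base }
    spineOf (graft e s t) with spineOf s | spineOf t
    ... | record { h = h ; spine = p ; high = h≥ ; size≡ = p≡ ; covers = pc }
        | record { h = k ; spine = q ; high = k≥ ; size≡ = q≡ ; covers = qc } with h ≤? suc k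
    ...   | yes h≤1+k = record
            { spine  = ext e s (≤-trans h≥ h≤1+k) q
            ; high   = ⊔-lub (≤-trans h≥ h≤1+k) (s≤s k≥)
            ; size≡  = cong (size s +_) q≡
            ; covers = λ { (left x∈) → top x∈ ; (right x∈) → down (qc x∈) } }
    ...   | no h≰1+k = record
            { spine  = graftTop e t b p
            ; high   = ⊔-lub h≥ b
            ; size≡  = trans (sizeˢ-graftTop e t b p) (cong (_+ size t) p≡)
            ; covers = λ { (left x∈)  → ∈-graftTopˡ e t b p (pc x∈)
                         ; (right x∈) → ∈-graftTopʳ e t b p x∈ } }
      where
      b : suc (height t) ≤ h
      b = ≤-trans (s≤s k≥) (<⇒≤ (≰⇒> h≰1+k))

    within-spine : ∀ {h v x} (p : Spine h v) → x ∈ˢ p → Within h v x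
    within-spine (base s b)    (base x∈) = within-mono b (within-height s x∈)
    within-spine (ext e s b p) (top x∈)  = within-mono b (within-height s x∈)
    within-spine (ext e s b p) (down x∈) = step e (within-spine p x∈)

    -- Fits r p: the ball of radius r around p_r (around the root if h < r) contains p.
    Fits : ∀ {h v} → ℕ → Spine h v → Set
    Fits r (base s b)        = ⊤
    Fits r (ext {h} e s b p) = Fits r p × suc h + height s ≤ r + r

    fits-mono : ∀ {h v r r′} (p : Spine h v) → r ≤ r′ → Fits r p → Fits r′ p
    fits-mono (base s b)    r≤r′ _       = tt
    fits-mono (ext e s b p) r≤r′ (f , l) = fits-mono p r≤r′ f , ≤-trans l (+-mono-≤ r≤r′ r≤r′)

    fits-deep : ∀ {h v r} (p : Spine h v) k → h ≡ k + r → Fits r p →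
                ∃[ c ] Within k c v × (∀ {x} → x ∈ˢ p → Within r c x)
    fits-deep p zero refl _ = _ , here , within-spine p
    fits-deep {r = r} (ext {h} e s b p) (suc k) eq (f , l)
      with fits-deep p k (suc-injective eq) f
    ... | c , c-u , c-p = c , c-v , λ where
          (top x∈)  → within-mono bound (within-trans c-v (within-height s x∈))
          (down x∈) → c-p x∈
      where
      c-v : Within (suc k) c _
      c-v = within-snoc c-u (~-sym e)
      bound : suc k + height s ≤ r
      bound = +-cancelʳ-≤ r _ r (≤-trans (≤-reflexive
        (trans (lemma (suc k) (height s) r) (cong (_+ height s) (sym eq)))) l)
        where
        lemma : ∀ x y z → x + y + z ≡ x + z + y
        lemma = solve-∀

    fits-cover : ∀ {h v r} (p : Spine h v) → Fits r p → ∃[ c ] (∀ {x} → x ∈ˢ p → Within r c x)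
    fits-cover {h} {v} {r} p f with ≤-total h r
    ... | inj₁ h≤r = v , λ x∈ → within-mono h≤r (within-spine p x∈)
    ... | inj₂ r≤h with m≤n⇒∃[o]m+o≡n r≤h
    ...   | k , eq with fits-deep p k (trans (sym eq) (+-comm r k)) f
    ...     | c , _ , cov = c , cov

    -- Cut r p m g: level m is the lowest one which the ball of radius r around
    -- p_r does not contain, and g vertices lie below that level.
    data Cut (r : ℕ) : ∀ {h v} → Spine h v → ℕ → ℕ → Set where
      here  : ∀ {h v u} {e : v ~ u} {s b} {p : Spine h u} →
              Fits r p → r + r < suc h + height s → Cut r (ext e s b p) (suc h) (sizeˢ p)
      there : ∀ {h v u m g} {e : v ~ u} {s b} {p : Spine h u} →
              Cut r p m g → Cut r (ext e s b p) m g

    cut? : ∀ {h v} r (p : Spine h v) → Fits r p ⊎ ∃[ m ] ∃[ g ] Cut r p m g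
    cut? r (base s b) = inj₁ tt
    cut? r (ext {h} e s b p) with cut? r p
    ... | inj₂ (m , g , c) = inj₂ (m , g , there c)
    ... | inj₁ f with suc h + height s ≤? r + r
    ...   | yes l = inj₁ (f , l)
    ...   | no ¬l = inj₂ (_ , _ , here f (≰⇒> ¬l))

    cut⇒¬fits : ∀ {h v r m g} {p : Spine h v} → Cut r p m g → ¬ Fits r p
    cut⇒¬fits (here _ l<) (_ , l) = <⇒≱ l< l
    cut⇒¬fits (there c)   (f , _) = cut⇒¬fits c f

    cut-level : ∀ {h v r m g} {p : Spine h v} → Cut r p m g → r < m × m ≤ g × m ≤ h
    cut-level {r = r} (here {h} {s = s} {b = b} {p = p} _ l<) =
      ≰⇒> (λ h<r → <⇒≱ l< (+-mono-≤ h<r (≤-trans b h<r))) , height<sizeˢ p , ≤-refl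
    cut-level (there c) with cut-level c
    ... | r<m , m≤g , m≤h = r<m , m≤g , m≤n⇒m≤1+n m≤h

    cut-size : ∀ {h v r m g} {p : Spine h v} → Cut r p m g →
               g + (r + r) + 2 + h ≤ sizeˢ p + (m + m)
    cut-size {r = r} (here {h} {s = s} {p = p} _ l<) = linear 0 (+-mono-≤ l< (height<size s))
      (lemma (sizeˢ p) r h (height s) (size s))
      where
      lemma : ∀ z r h d y → z + (r + r) + 2 + suc h + (suc h + d + y) + 0 ≡
              y + z + (suc h + suc h) + (suc (r + r) + suc d)
      lemma = solve-∀
    cut-size {r = r} {m} {g} (there {h} {s = s} {p = p} c) =
      linear 0 (+-mono-≤ (cut-size c) (≤-trans (s≤s z≤n) (height<size s)))
        (lemma g r h m (sizeˢ p) (size s))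
      where
      lemma : ∀ g r h m z y → g + (r + r) + 2 + suc h + (z + (m + m) + y) + 0 ≡
              y + z + (m + m) + (g + (r + r) + 2 + h + 1)
      lemma = solve-∀

    cut-gap : ∀ {h v r r′ m m′ g g′} {p : Spine h v} → r ≤ r′ → Cut r p m g → Cut r′ p m′ g′ →
              g ≡ g′ ⊎ ∃[ k ] r′ ≤ k × m ≤ k × g + (r + r) + 2 + k ≤ g′ + (m + m)
    cut-gap r≤r′ (here _ _) (here _ _)                    = inj₁ refl
    cut-gap {p = ext _ _ _ p} r≤r′ (here f _) (there c′) =
      contradiction (fits-mono p r≤r′ f) (cut⇒¬fits c′)
    cut-gap r≤r′ (there c) c′@(here _ _)                 =
      inj₂ (_ , ≤-pred (proj₁ (cut-level c′)) , proj₂ (proj₂ (cut-level c)) , cut-size c)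
    cut-gap r≤r′ (there c) (there c′)                    = cut-gap r≤r′ c c′

    Removes : ∀ {v} → Tree v → ℕ → ℕ → Set
    Removes {v} t r g = Σ[ t′ ∈ Tree v ] size t′ + g ≡ size t ×
      ∃[ c ] (∀ {x} → x ∈ᵗ t → Within r c x ⊎ x ∈ᵗ t′)

    cut-removes : ∀ {h v r m g} {p : Spine h v} → Cut r p m g → Σ[ t′ ∈ Tree v ]
      size t′ + g ≡ sizeˢ p × ∃[ c ] (∀ {x} → x ∈ˢ p → Within r c x ⊎ x ∈ᵗ t′)
    cut-removes (here {s = s} {p = p} f _) with fits-cover p f
    ... | c , cov = s , refl , c , λ { (top x∈) → inj₂ x∈ ; (down x∈) → inj₁ (cov x∈) }
    cut-removes {g = g} (there {e = e} {s} {p = p} ct) with cut-removes ct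
    ... | t , eq , c , cov = graft e s t
        , trans (+-assoc (size s) (size t) g) (cong (size s +_) eq) , c , λ where
            (top x∈)  → inj₂ (left x∈)
            (down x∈) → map₂ right (cov x∈)

    -- A ball of radius r removes everything below level m, which is where
    -- m + height exceeds 2 r. Hence a larger ball either stops at the same level
    -- or also gets the obstacle, which together with the path below it has at
    -- least 2 r + 2 vertices.
    record Gains {v} (t : Tree v) (M : ℕ) : Set where
      field
        gain    : ℕ → ℕ
        removes : ∀ {r} → r ≤ M → Removes t r (gain r)
        large   : ∀ {r} → r ≤ M → r < gain r
        room    : ∀ {r} → r ≤ M → 2 * r + 2 ≤ size t
        jump    : ∀ {r r′} → r ≤ r′ → r′ ≤ M → gain r ≡ gain r′ ⊎ 2 * r + 2 ≤ gain r′
        pair    : ∀ {r r′} → r ≤ r′ → r′ ≤ M → gain r ≤ r′ → r′ + 2 * r + 2 ≤ gain r + gain r′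

    gains : ∀ {v} (t : Tree v) M → (∃[ c ] (∀ {x} → x ∈ᵗ t → Within M c x)) ⊎ Gains t M
    gains t M with spineOf t
    ... | record { h = h ; spine = p ; size≡ = p≡ ; covers = pc } with cut? M p
    ...   | inj₁ f with fits-cover p f
    ...     | c , cov = inj₁ (c , λ x∈ → cov (pc x∈))
    gains {v} t M | record { h = h ; spine = p ; size≡ = p≡ ; covers = pc } | inj₂ (mM , gM , cM) =
      inj₂ (record
        { gain = gain ; removes = removes ; large = large ; room = room ; jump = jump ; pair = pair })
      where
      lemma : ∀ r m g h z → 2 * r + 2 + (g + h + (z + (m + m))) + 0 ≡
              z + (m + m + (g + (r + r) + 2 + h))
      lemma = solve-∀
      gain : ℕ → ℕ
      gain r with cut? r p
      ... | inj₁ _           = 0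
      ... | inj₂ (m , g , _) = g
      gain-cut : ∀ {r} → r ≤ M → ∃[ m ] Cut r p m (gain r)
      gain-cut {r} r≤M with cut? r p
      ... | inj₁ f           = contradiction (fits-mono p r≤M f) (cut⇒¬fits cM)
      ... | inj₂ (m , _ , c) = m , c
      removes : ∀ {r} → r ≤ M → Removes t r (gain r)
      removes r≤M with cut-removes (proj₂ (gain-cut r≤M))
      ... | t′ , eq , c , cov = t′ , trans eq p≡ , c , λ x∈ → cov (pc x∈)
      large : ∀ {r} → r ≤ M → r < gain r
      large r≤M with cut-level (proj₂ (gain-cut r≤M))
      ... | r<m , m≤g , _ = ≤-trans r<m m≤g
      room : ∀ {r} → r ≤ M → 2 * r + 2 ≤ size t
      room {r} r≤M with gain-cut r≤M
      ... | m , c with cut-level c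
      ...   | _ , m≤g , m≤h = ≤-trans
        (linear 0 (+-mono-≤ (+-mono-≤ m≤g m≤h) (cut-size c)) (lemma r m (gain r) h (sizeˢ p)))
        (≤-reflexive p≡)
      jump : ∀ {r r′} → r ≤ r′ → r′ ≤ M → gain r ≡ gain r′ ⊎ 2 * r + 2 ≤ gain r′
      jump {r} {r′} r≤r′ r′≤M with gain-cut (≤-trans r≤r′ r′≤M)
      ... | m , c with cut-gap r≤r′ c (proj₂ (gain-cut r′≤M))
      ...   | inj₁ eq                = inj₁ eq
      ...   | inj₂ (k , _ , m≤k , le) = inj₂
        (linear 0 (+-mono-≤ (+-mono-≤ (proj₁ (proj₂ (cut-level c))) m≤k) le)
          (lemma r m (gain r) k (gain r′)))
      pair : ∀ {r r′} → r ≤ r′ → r′ ≤ M → gain r ≤ r′ → r′ + 2 * r + 2 ≤ gain r + gain r′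
      pair {r} {r′} r≤r′ r′≤M g≤r′ with gain-cut (≤-trans r≤r′ r′≤M)
      ... | m , c with cut-gap r≤r′ c (proj₂ (gain-cut r′≤M))
      ...   | inj₁ eq =
        contradiction (≤-trans (large r′≤M) (≤-trans (≤-reflexive (sym eq)) g≤r′)) 1+n≰n
      ...   | inj₂ (k , r′≤k , _ , le) =
        linear 0 (+-mono-≤ (+-mono-≤ (+-mono-≤ m≤g m≤g) r′≤k) le)
          (lemma′ r r′ m (gain r) k (gain r′))
        where
        m≤g = proj₁ (proj₂ (cut-level c))
        lemma′ : ∀ r s m g h z → s + 2 * r + 2 + (g + g + h + (z + (m + m))) + 0 ≡
                 g + z + (m + m + s + (g + (r + r) + 2 + h))
        lemma′ = solve-∀

module CoveringGame where

  open TreeGains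
  open import Data.Empty using (⊥)
  open import Data.List.Base using (List; []; _∷_; _++_; length; downFrom; applyDownFrom)
  open import Data.List.Membership.Propositional using (_∈_)
  open import Data.List.Properties using (++-assoc; length-applyDownFrom; length-++-sucʳ)
  open import Data.List.Relation.Binary.Pointwise as Pointwise using (Pointwise; []; _∷_)
  open import Data.List.Relation.Unary.All as All using (All; []; _∷_)
  open import Data.List.Relation.Unary.All.Properties using (¬Any⇒All¬)
  open import Data.List.Relation.Unary.AllPairs using (AllPairs; []; _∷_)
  open import Data.List.Relation.Unary.AllPairs.Properties using (applyDownFrom⁺₁)
  open import Data.List.Relation.Unary.Any using (Any; here; there; any?)
  open import Data.Nat.Base using (ℕ; zero; suc; _+_; _*_; _∸_; _≤_; _<_; _≥_; z≤n; s≤s)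
  open import Data.Nat.Induction using (<-rec)
  open import Data.Nat.Properties
  open import Data.Nat.Tactic.RingSolver using (solve-∀)
  open import Data.Product using (∃-syntax; _×_; _,_; proj₁; proj₂)
  open import Data.Sum using (_⊎_; inj₁; inj₂)
  open import Data.Unit.Base using (⊤; tt)
  open import Level using (0ℓ)
  open import Relation.Binary.PropositionalEquality using (_≡_; _≢_; refl; sym; trans; cong; subst)
  open import Relation.Nullary using (¬_; yes; no; contradiction)
  open import Relation.Unary as Unary using (Pred)

  Descending : List ℕ → Set
  Descending = AllPairs _≥_

  all-delete : ∀ {P : Pred ℕ 0ℓ} us {r vs} → All P (us ++ r ∷ vs) → All P (us ++ vs)
  all-delete []       (_ ∷ ps) = ps
  all-delete (u ∷ us) (p ∷ ps) = p ∷ all-delete us ps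

  descending-delete : ∀ us {r vs} → Descending (us ++ r ∷ vs) → Descending (us ++ vs)
  descending-delete []       (_ ∷ d) = d
  descending-delete (u ∷ us) (p ∷ d) = all-delete us p ∷ descending-delete us d

  descending-after : ∀ us {r vs} → Descending (us ++ r ∷ vs) → All (r ≥_) vs
  descending-after []       (p ∷ _) = p
  descending-after (u ∷ us) (_ ∷ d) = descending-after us d

  last-satisfying : ∀ {P : ℕ → Set} → Unary.Decidable P → ∀ T → Any P T →
    ∃[ us ] ∃[ r ] ∃[ vs ] T ≡ us ++ r ∷ vs × P r × All (λ s → ¬ P s) vs
  last-satisfying P? (s ∷ T) any with any? P? T
  ... | yes p with last-satisfying P? T p
  ...   | us , r , vs , eq , pr , none = s ∷ us , r , vs , cong (s ∷_) eq , pr , none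
  last-satisfying P? (s ∷ T) (here p)  | no ¬p = [] , s , T , refl , p , ¬Any⇒All¬ T ¬p
  last-satisfying P? (s ∷ T) (there p) | no ¬p = contradiction p ¬p

  -- Ranked φ i T for a descending list T: every s ∈ T satisfies φ (number of
  -- elements before s, increased by i) s (number of elements from s on).
  Ranked : (ℕ → ℕ → ℕ → Set) → ℕ → List ℕ → Set
  Ranked φ i []      = ⊤
  Ranked φ i (s ∷ T) = φ i s (suc (length T)) × Ranked φ (suc i) T

  module _ {φ ψ : ℕ → ℕ → ℕ → Set} where

    ranked-map : (∀ {i s j} → φ i s j → ψ i s j) → ∀ {i} T → Ranked φ i T → Ranked ψ i T
    ranked-map f []      _        = tt
    ranked-map f (s ∷ T) (p , ps) = f p , ranked-map f T ps

    ranked-shift : ∀ {i} vs → (∀ {i s j} → s ∈ vs → φ (suc i) s j → ψ i s j) →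
                   Ranked φ (suc i) vs → Ranked ψ i vs
    ranked-shift []       g _        = tt
    ranked-shift (v ∷ vs) g (p , ps) = g (here refl) p , ranked-shift vs (λ s∈ → g (there s∈)) ps

    ranked-delete : ∀ {i} us {r vs} →
      (∀ {i s j} → s ∈ us → φ i s (suc j) → ψ i s j) →
      (∀ {i s j} → s ∈ vs → φ (suc i) s j → ψ i s j) →
      Ranked φ i (us ++ r ∷ vs) → Ranked ψ i (us ++ vs)
    ranked-delete []       f g (_ , ps) = ranked-shift _ g ps
    ranked-delete {i} (u ∷ us) f g (p , ps) =
      f (here refl) (subst (φ i u) (cong suc (length-++-sucʳ us _ _)) p) ,
      ranked-delete us (λ s∈ → f (there s∈)) g ps

  tops : ℕ → ℕ → List ℕ
  tops a = applyDownFrom (a +_)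

  tops++downFrom : ∀ a N → tops a N ++ downFrom a ≡ downFrom (N + a)
  tops++downFrom a zero    = refl
  tops++downFrom a (suc N) rewrite +-comm a N = cong (N + a ∷_) (tops++downFrom a N)

  tops-descending : ∀ a N → Descending (tops a N)
  tops-descending a N = applyDownFrom⁺₁ (a +_) N (λ j<i _ → +-monoʳ-≤ a (<⇒≤ j<i))

  tops-ranked : ∀ {φ} a i N → (∀ i′ j → i′ ≥ i → i′ + suc j ≡ i + N → φ i′ (a + j) (suc j)) →
                Ranked φ i (tops a N)
  tops-ranked a i zero    f = tt
  tops-ranked {φ} a i (suc N) f =
    subst (φ i (a + N)) (cong suc (sym (length-applyDownFrom (a +_) N))) (f i N ≤-refl refl) ,
    tops-ranked a (suc i) N
      (λ i′ j i′≥ eq → f i′ j (≤-trans (n≤1+n i) i′≥) (trans eq (sym (+-suc i N))))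

  div₃ : ∀ p q → 3 * p ≤ 2 + 3 * q → p ≤ q
  div₃ p q le with p ≤? q
  ... | yes p≤q = p≤q
  ... | no p≰q  = contradiction
    (≤-trans (≤-trans (≤-reflexive (sym (*-suc 3 q))) (*-monoʳ-≤ 3 (≰⇒> p≰q))) le) 1+n≰n

  budget : ℕ → ℕ
  budget k = k * (2 * k + 3)

  module Game {n} (G : Graph n) where
    open Trees G

    Swallowed : ∀ {v} → ℕ → Tree v → Set
    Swallowed r t = ∃[ c ] (∀ {x} → x ∈ᵗ t → Within r c x)

    swallow : ∀ {v r L} {t : Tree v} → Swallowed r t → Cover (r ∷ L) (_∈ᵗ t)
    swallow (c , cov) = ball {Q = λ _ → ⊥} c (λ x∈ → inj₁ (cov x∈)) (done λ _ ())

    -- The smallest ball gaining at least θ: it gains 2 s + 2 for every smaller s as well.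
    top-move : ∀ {v M T θ L} {t : Tree v} (g : Gains t M) → Descending (M ∷ T) → θ ≤ Gains.gain g M →
      (∀ us {r vs} {t′ : Tree v} {γ} → M ∷ T ≡ us ++ r ∷ vs → size t′ + γ ≡ size t → θ ≤ γ →
        (∀ {s} → s ∈ us → s ≤ M) → (∀ {s} → s ∈ vs → 2 * s + 2 ≤ γ) → Descending (us ++ vs) →
        Cover ((us ++ vs) ++ L) (_∈ᵗ t′)) →
      Cover ((M ∷ T) ++ L) (_∈ᵗ t)
    top-move {M = M} {T} {θ} {L} g desc@(M≥ ∷ _) θ≤ next
      with last-satisfying (λ s → θ ≤? Gains.gain g s) (M ∷ T) (here θ≤)
    ... | us , r , vs , eq , θ≤r , small =
      subst (λ R → Cover (R ++ L) _) (sym eq)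
        (subst (λ R → Cover R _) (sym (++-assoc us (r ∷ vs) L))
          (cover-insert us c cov
            (subst (λ R → Cover R (_∈ᵗ proj₁ rem)) (++-assoc us vs L)
              (next us {t′ = proj₁ rem} eq t′≡ θ≤r us≤ below (descending-delete us desc′)))))
      where
      open Gains g
      all≤ : All (_≤ M) (us ++ r ∷ vs)
      all≤ = subst (All (_≤ M)) eq (≤-refl ∷ M≥)
      desc′ : Descending (us ++ r ∷ vs)
      desc′ = subst Descending eq desc
      middle≤ : ∀ us → All (_≤ M) (us ++ r ∷ vs) → r ≤ M
      middle≤ []       (p ∷ _)  = p
      middle≤ (_ ∷ us) (_ ∷ ps) = middle≤ us ps
      front≤ : ∀ us → All (_≤ M) (us ++ r ∷ vs) → ∀ {s} → s ∈ us → s ≤ M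
      front≤ (_ ∷ us) (p ∷ _)  (here refl) = p
      front≤ (_ ∷ us) (_ ∷ ps) (there s∈)  = front≤ us ps s∈
      us≤ : ∀ {s} → s ∈ us → s ≤ M
      us≤ = front≤ us all≤
      r≤M : r ≤ M
      r≤M = middle≤ us all≤
      rem = removes r≤M
      t′≡ = proj₁ (proj₂ rem)
      c = proj₁ (proj₂ (proj₂ rem))
      cov = proj₂ (proj₂ (proj₂ rem))
      below : ∀ {s} → s ∈ vs → 2 * s + 2 ≤ gain r
      below {s} s∈ with jump (All.lookup (descending-after us desc′) s∈) r≤M
      ... | inj₁ eq′ = contradiction (subst (θ ≤_) (sym eq′) θ≤r) (All.lookup small s∈)
      ... | inj₂ le  = le

    record TopBound (n i s j : ℕ) : Set where
      constructor topBound
      field total : n ≤ i * (2 * s + 2) + j * (s + 1) + s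

    cover-tops : ∀ f {v L} T (t : Tree v) → length T ≤ f → T ≢ [] → Descending T →
                 Ranked (TopBound (size t)) 0 T → Cover (T ++ L) (_∈ᵗ t)
    cover-tops f       []      t _         T≢[] _    _  = contradiction refl T≢[]
    cover-tops (suc f) {v} {L} (M ∷ T) t (s≤s len≤) _ desc rk with gains t M
    ... | inj₁ sw = swallow sw
    ... | inj₂ g  = top-move g desc (Gains.large g ≤-refl) next
      where
      arith₁ : ∀ i s j → i * (2 * s + 2) + suc j * (s + 1) + s ≡
               i * (2 * s + 2) + j * (s + 1) + s + (s + 1)
      arith₁ = solve-∀
      arith₂ : ∀ i s j → suc i * (2 * s + 2) + j * (s + 1) + s ≡
               i * (2 * s + 2) + j * (s + 1) + s + (2 * s + 2)
      arith₂ = solve-∀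
      drop : ∀ {n′ γ x y} → n′ + γ ≡ size t → size t ≤ x + y → y ≤ γ → n′ ≤ x
      drop {n′} {γ} {x} eq le y≤ = +-cancelʳ-≤ γ n′ x
        (≤-trans (≤-reflexive eq) (≤-trans le (+-monoʳ-≤ x y≤)))
      next : ∀ us {r vs} {t′ : Tree v} {γ} → M ∷ T ≡ us ++ r ∷ vs → size t′ + γ ≡ size t → suc M ≤ γ →
        (∀ {s} → s ∈ us → s ≤ M) → (∀ {s} → s ∈ vs → 2 * s + 2 ≤ γ) → Descending (us ++ vs) →
        Cover ((us ++ vs) ++ L) (_∈ᵗ t′)
      next us {r} {vs} {t′} {γ} eq t≡ M<γ us≤ below desc′ =
        cover-tops f (us ++ vs) t′
          (≤-pred (≤-trans (≤-reflexive (trans (sym (length-++-sucʳ us _ _)) (cong length (sym eq)))) (s≤s len≤)))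
          (nonempty us vs eq) desc′
          (ranked-delete us
            (λ {i} {s} {j} s∈ (topBound b) → topBound (drop t≡ (≤-trans b (≤-reflexive (arith₁ i s j)))
               (≤-trans (≤-reflexive (+-comm s 1)) (≤-trans (s≤s (us≤ s∈)) M<γ))))
            (λ {i} {s} {j} s∈ (topBound b) →
               topBound (drop t≡ (≤-trans b (≤-reflexive (arith₂ i s j))) (below s∈)))
            (subst (Ranked (TopBound (size t)) 0) eq rk))
        where
        single : ∀ M → 1 * (M + 1) + M + 1 ≡ 2 * M + 2
        single = solve-∀
        nonempty : ∀ us vs → M ∷ T ≡ us ++ r ∷ vs → us ++ vs ≢ []
        nonempty [] [] refl _ = contradiction
          (≤-trans (≤-reflexive (+-comm 1 _)) (≤-trans (+-monoˡ-≤ 1 (TopBound.total (proj₁ rk)))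
            (≤-trans (≤-reflexive (single M)) (Gains.room g ≤-refl)))) 1+n≰n

    Coverable : ℕ → Set₁
    Coverable k = ∀ {v} (t : Tree v) → 3 * size t + 3 ≤ budget k → Cover (downFrom k) (_∈ᵗ t)

    module Phase (k a : ℕ) (IH : ∀ {m} → m < k → Coverable m) (1≤a : 1 ≤ a) (4a<3k : 4 * a < 3 * k) where

      -- The radii are 0, …, ℓ - 1 and a list of tops. If s is a top with i tops
      -- before it and j tops from it on, then removing the former gains at least
      -- 2 s + 2 vertices each, and the latter are meant to gain s + 2 each.
      record Bound (ℓ n i s j : ℕ) : Set where
        constructor bound
        field
          rank  : a + j ≤ suc s
          total : 3 * n + 3 ≤ budget ℓ + 3 * (i * (2 * s + 2) + j * (s + 2))
      open Bound

      bound⇒topBound : ∀ {ℓ n i s j} → ℓ ≤ 1 → Bound ℓ n i s j → TopBound n i s j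
      bound⇒topBound {ℓ} {n} {i} {s} {j} ℓ≤1 (bound aj≤ le) =
        topBound (div₃ n _ (linear 0 (+-mono-≤ (+-mono-≤ le budget≤5) (*-monoʳ-≤ 3 j≤s))
          (arith n i s j (budget ℓ))))
        where
        j≤s : j ≤ s
        j≤s = ≤-pred (≤-trans (+-monoˡ-≤ j 1≤a) aj≤)
        budget≤5 : budget ℓ ≤ 5
        budget≤5 = *-mono-≤ ℓ≤1 (+-monoˡ-≤ 3 (*-monoʳ-≤ 2 ℓ≤1))
        arith : ∀ n i s j y →
          3 * n + (y + 3 * (i * (2 * s + 2) + j * (s + 2)) + 5 + 3 * s) + 0 ≡
          2 + 3 * (i * (2 * s + 2) + j * (s + 1) + s) + (3 * n + 3 + y + 3 * j)
        arith = solve-∀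

      dominates : ∀ {ℓ n i} T → ℓ ≤ a → Ranked (Bound ℓ n) i T →
                  Pointwise _≤_ (downFrom (length T + ℓ)) (T ++ downFrom ℓ)
      dominates []          ℓ≤a _              = Pointwise.refl ≤-refl
      dominates {ℓ} (s ∷ T) ℓ≤a (bound aj≤ _ , rk) =
        ≤-pred (≤-trans (≤-trans (≤-reflexive (+-comm (suc (length T)) ℓ)) (+-monoˡ-≤ (suc (length T)) ℓ≤a)) aj≤)
        ∷ dominates T ℓ≤a rk

      shift-bound : ∀ {ℓ n n′ γ i s j} → n′ + γ ≡ n → 2 * s + 2 ≤ γ →
                    Bound ℓ n (suc i) s j → Bound ℓ n′ i s j
      shift-bound {ℓ} {n′ = n′} {γ} {i} {s} {j} refl s≤ (bound aj≤ le) =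
        bound aj≤ (linear 0 (+-mono-≤ (*-monoʳ-≤ 3 s≤) le) (arith n′ γ i s j (budget ℓ)))
        where
        arith : ∀ n γ i s j y →
          3 * n + 3 + (3 * γ + (y + 3 * (suc i * (2 * s + 2) + j * (s + 2)))) + 0 ≡
          y + 3 * (i * (2 * s + 2) + j * (s + 2)) + (3 * (2 * s + 2) + (3 * (n + γ) + 3))
        arith = solve-∀

      delete-bound : ∀ {ℓ n n′ γ M} us {r vs} → n′ + γ ≡ n → M + 2 ≤ γ →
        (∀ {s} → s ∈ us → s ≤ M) → (∀ {s} → s ∈ vs → 2 * s + 2 ≤ γ) → ∀ {i} →
        Ranked (Bound ℓ n) i (us ++ r ∷ vs) → Ranked (Bound ℓ n′) i (us ++ vs)
      delete-bound {ℓ} {n} {n′} {γ} {M} us refl M≤ us≤ below = ranked-delete us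
        (λ {i} {s} {j} s∈ (bound aj≤ le) → bound (≤-trans (+-monoʳ-≤ a (n≤1+n j)) aj≤)
          (linear 0 (+-mono-≤ (*-monoʳ-≤ 3 (≤-trans (+-monoˡ-≤ 2 (us≤ s∈)) M≤)) le)
            (arith n′ γ i s j (budget ℓ))))
        (λ s∈ → shift-bound refl (below s∈))
        where
        arith : ∀ n γ i s j y →
          3 * n + 3 + (3 * γ + (y + 3 * (i * (2 * s + 2) + suc j * (s + 2)))) + 0 ≡
          y + 3 * (i * (2 * s + 2) + j * (s + 2)) + (3 * (s + 2) + (3 * (n + γ) + 3))
        arith = solve-∀

      lower-bound : ∀ {x n n′ γ i s j} → n′ + γ ≡ n → 4 * x + 5 ≤ 3 * γ →
                    Bound (suc x) n i s j → Bound x n′ i s j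
      lower-bound {x} {n} {n′} {γ} {i} {s} {j} refl γ≥ (bound aj≤ le) =
        bound aj≤ (linear 0 (+-mono-≤ γ≥ le) (arith n′ γ x (3 * (i * (2 * s + 2) + j * (s + 2)))))
        where
        arith : ∀ n γ x z →
          3 * n + 3 + (3 * γ + (suc x * (2 * suc x + 3) + z)) + 0 ≡
          x * (2 * x + 3) + z + (4 * x + 5 + (3 * (n + γ) + 3))
        arith = solve-∀

      a<k : a < k
      a<k = *-cancelˡ-< 3 a k (≤-<-trans (*-monoˡ-≤ a (n≤1+n 3)) 4a<3k)

      cover-phase : ∀ f {v ℓ} T (t : Tree v) → ℓ + length T ≤ f → ℓ ≤ a → Descending T →
        (T ≡ [] → 3 * size t + 3 ≤ budget ℓ) → Ranked (Bound ℓ (size t)) 0 T →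
        Cover (T ++ downFrom ℓ) (_∈ᵗ t)
      cover-phase f [] t _ ℓ≤a _ spent _ = IH (≤-<-trans ℓ≤a a<k) t (spent refl)
      cover-phase f {ℓ = 0} (M ∷ T) t _ _ desc _ rk =
        cover-tops _ (M ∷ T) t ≤-refl (λ ()) desc (ranked-map (bound⇒topBound z≤n) (M ∷ T) rk)
      cover-phase f {ℓ = 1} (M ∷ T) t _ _ desc _ rk =
        cover-tops _ (M ∷ T) t ≤-refl (λ ()) desc (ranked-map (bound⇒topBound ≤-refl) (M ∷ T) rk)
      cover-phase (suc f) {v} {suc x@(suc _)} (M ∷ T) t (s≤s len≤) ℓ≤a desc _ rk with gains t M
      ... | inj₁ sw = swallow sw
      ... | inj₂ g  = move
        where
        open Gains g
        ℓ = suc x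
        N = suc (length T)
        γ = gain x
        a≤M : a + N ≤ suc M
        a≤M = rank (proj₁ rk)
        x≤M : x ≤ M
        x≤M = ≤-trans (n≤1+n x) (≤-trans ℓ≤a
          (≤-pred (≤-trans (≤-reflexive (+-comm 1 a)) (≤-trans (+-monoʳ-≤ a (s≤s z≤n)) a≤M))))

        low-move : 4 * x + 5 ≤ 3 * γ → Cover ((M ∷ T) ++ downFrom ℓ) (_∈ᵗ t)
        low-move γ≥ with removes x≤M
        ... | t′ , t′≡ , c , cov = cover-insert (M ∷ T) c cov
          (cover-phase f (M ∷ T) t′ len≤ (≤-trans (n≤1+n x) ℓ≤a) desc (λ ())
            (ranked-map (lower-bound t′≡ γ≥) (M ∷ T) rk))

        dominated : 3 * γ ≤ 4 * ℓ → M < γ → Cover ((M ∷ T) ++ downFrom ℓ) (_∈ᵗ t)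
        dominated γ≤ M<γ = cover-mono (dominates (M ∷ T) ℓ≤a rk) (IH small t enough)
          where
          M≤ : 3 * suc M ≤ 4 * ℓ
          M≤ = ≤-trans (*-monoʳ-≤ 3 M<γ) γ≤
          small : N + ℓ < k
          small = *-cancelˡ-< 3 (N + ℓ) k (≤-<-trans
            (≤-trans (*-monoʳ-≤ 3 (≤-trans (+-monoʳ-≤ N ℓ≤a) (≤-trans (≤-reflexive (+-comm N a)) a≤M)))
              (≤-trans M≤ (*-monoʳ-≤ 4 ℓ≤a))) 4a<3k)
          arith : ∀ n N M l →
            3 * n + 3 + (N * (4 * l) + (l * (2 * l + 3) + 3 * (N * (M + 2)))) + 2 * (N * N) ≡
            (N + l) * (2 * (N + l) + 3) + (N * (3 * suc M) + (3 * n + 3))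
          arith = solve-∀
          enough : 3 * size t + 3 ≤ budget (N + ℓ)
          enough = linear (2 * (N * N)) (+-mono-≤ (*-monoʳ-≤ N M≤) (total (proj₁ rk)))
            (arith (size t) N M ℓ)

        high-move : 3 * γ ≤ 4 * ℓ → γ ≤ M → Cover ((M ∷ T) ++ downFrom ℓ) (_∈ᵗ t)
        high-move γ≤ γ≤M = top-move g desc M+2≤ next
          where
          arith : ∀ M x γ δ → 3 * (M + 2) + (3 * (γ + δ) + 4 * suc x + 2 * x) + 0 ≡
                  2 + 3 * δ + (3 * (M + 2 * x + 2) + 3 * γ + 2)
          arith = solve-∀
          M+2≤ : M + 2 ≤ gain M
          M+2≤ = div₃ (M + 2) (gain M) (linear 0
            (+-mono-≤ (+-mono-≤ (*-monoʳ-≤ 3 (pair x≤M ≤-refl γ≤M)) γ≤) (*-monoʳ-≤ 2 (s≤s z≤n)))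
            (arith M x γ (gain M)))
          last : ∀ n γ M y → 3 * n + 3 + (3 * γ + (y + 3 * (1 * (M + 2)))) + 0 ≡
                 y + (3 * (M + 2) + (3 * (n + γ) + 3))
          last = solve-∀
          single : ∀ us vs {r n′ γ} → M ∷ T ≡ us ++ r ∷ vs → n′ + γ ≡ size t → M + 2 ≤ γ →
                   us ++ vs ≡ [] → 3 * n′ + 3 ≤ budget ℓ
          single [] [] {n′ = n′} {γ} refl n′≡ M≤γ _ = linear 0
            (+-mono-≤ (*-monoʳ-≤ 3 M≤γ) (≤-trans (≤-reflexive (cong (λ n → 3 * n + 3) n′≡)) (total (proj₁ rk))))
            (last n′ γ M (budget ℓ))
          next : ∀ us {r vs} {t′ : Tree v} {γ} → M ∷ T ≡ us ++ r ∷ vs → size t′ + γ ≡ size t → M + 2 ≤ γ →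
            (∀ {s} → s ∈ us → s ≤ M) → (∀ {s} → s ∈ vs → 2 * s + 2 ≤ γ) → Descending (us ++ vs) →
            Cover ((us ++ vs) ++ downFrom ℓ) (_∈ᵗ t′)
          next us {r} {vs} {t′} {γ} eq t≡ M≤γ us≤ below desc′ =
            cover-phase f (us ++ vs) t′
              (≤-trans (≤-reflexive (trans (cong (ℓ +_) (suc-injective
                (trans (sym (length-++-sucʳ us _ _)) (cong length (sym eq))))) (sym (+-suc x (length T))))) len≤)
              ℓ≤a desc′ (single us vs eq t≡ M≤γ)
              (delete-bound us t≡ M≤γ us≤ below (subst (Ranked (Bound ℓ (size t)) 0) eq rk))

        γ≤ : ¬ 4 * x + 5 ≤ 3 * γ → 3 * γ ≤ 4 * ℓ
        γ≤ γ≱ = ≤-pred (≤-trans (≰⇒> γ≱) (≤-reflexive (arith x)))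
          where
          arith : ∀ x → 4 * x + 5 ≡ suc (4 * suc x)
          arith = solve-∀

        move : Cover ((M ∷ T) ++ downFrom ℓ) (_∈ᵗ t)
        move with 4 * x + 5 ≤? 3 * γ
        ... | yes γ≥ = low-move γ≥
        ... | no γ≱ with γ ≤? M
        ...   | yes γ≤M = high-move (γ≤ γ≱) γ≤M
        ...   | no γ≰M  = dominated (γ≤ γ≱) (≰⇒> γ≰M)

      -- For odd k the bound of the largest radius K falls short by H thirds of a
      -- vertex. This debt is paid off while K is still available: either the
      -- largest low radius x gains 2 x vertices or a top gains K + 3.
      cover-debt : ∀ K → 2 * a ≤ K + 2 → ∀ f {v q H} T (t : Tree v) → q + length T ≤ f →
        3 + q ≤ a → H ≤ q * q → H ≤ 3 * suc (length T) → Descending (K ∷ T) → a + suc (length T) ≤ suc K →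
        3 * size t + 3 ≤ budget (3 + q) + H + 3 * (suc (length T) * (K + 2)) →
        Ranked (Bound (3 + q) (size t)) 1 T → Cover ((K ∷ T) ++ downFrom (3 + q)) (_∈ᵗ t)
      cover-debt K 2a≤ f {q = zero} {H} T t len≤ ℓ≤a H≤0 _ desc K≥ le rk =
        cover-phase _ (K ∷ T) t ≤-refl ℓ≤a desc (λ ())
          (bound K≥ (linear 0 (+-mono-≤ H≤0 le) (arith (size t) H (suc (length T) * (K + 2)))) , rk)
        where
        arith : ∀ n H z → 3 * n + 3 + (0 + (27 + H + 3 * z)) + 0 ≡ 27 + 3 * z + (H + (3 * n + 3))
        arith = solve-∀
      cover-debt K 2a≤ (suc f) {v} {suc q} {H} T t (s≤s len≤) ℓ≤a H≤ H≤N desc K≥ le rk with gains t K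
      ... | inj₁ sw = swallow sw
      ... | inj₂ g  = move
        where
        open Gains g
        x = 3 + q
        ℓ = suc x
        γ = gain x
        2ℓ≤K+2 : 2 * ℓ ≤ K + 2
        2ℓ≤K+2 = ≤-trans (*-monoʳ-≤ 2 ℓ≤a) 2a≤
        2x≤K : 2 * x ≤ K
        2x≤K = linear 0 2ℓ≤K+2 (arith K x)
          where
          arith : ∀ K x → 2 * x + (K + 2) + 0 ≡ K + 2 * suc x
          arith = solve-∀
        x≤M : x ≤ K
        x≤M = ≤-trans (m≤m+n x (x + 0)) 2x≤K

        payment : 2 * x ≤ γ → ∃[ H′ ] H′ ≤ q * q × H′ ≤ H × budget ℓ + H ≤ budget x + H′ + 3 * γ
        payment γ≥ with ≤-total H (q * q)
        ... | inj₁ H≤q² = H , H≤q² , ≤-refl , linear (1 + 2 * q) (*-monoʳ-≤ 3 γ≥) (arith q H γ)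
          where
          arith : ∀ q H γ → (4 + q) * (2 * (4 + q) + 3) + H + 3 * γ + (1 + 2 * q) ≡
                  (3 + q) * (2 * (3 + q) + 3) + H + 3 * γ + 3 * (2 * (3 + q))
          arith = solve-∀
        ... | inj₂ q²≤H = q * q , ≤-refl , q²≤H , linear 0 (+-mono-≤ H≤ (*-monoʳ-≤ 3 γ≥)) (arith q H γ)
          where
          arith : ∀ q H γ → (4 + q) * (2 * (4 + q) + 3) + H + (suc q * suc q + 3 * γ) + 0 ≡
                  (3 + q) * (2 * (3 + q) + 3) + q * q + 3 * γ + (H + 3 * (2 * (3 + q)))
          arith = solve-∀

        low-move : 2 * x ≤ γ → Cover ((K ∷ T) ++ downFrom ℓ) (_∈ᵗ t)
        low-move γ≥ with removes x≤M | payment γ≥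
        ... | t′ , t′≡ , c , cov | H′ , H′≤q² , H′≤H , pay = cover-insert (K ∷ T) c cov
          (cover-debt K 2a≤ f {q = q} {H′} T t′ len≤ (≤-trans (n≤1+n x) ℓ≤a) H′≤q² (≤-trans H′≤H H≤N) desc K≥
            (linear 0 (+-mono-≤ pay (≤-trans (≤-reflexive (cong (λ n → 3 * n + 3) t′≡)) le))
              (arith (size t′) γ (budget x) (budget ℓ) H H′ (3 * (suc (length T) * (K + 2)))))
            (ranked-map (lower-bound t′≡ (≤-trans (linear (1 + 2 * q) ≤-refl (arith′ q)) (*-monoʳ-≤ 3 γ≥))) T rk))
          where
          arith : ∀ n γ y y′ H H′ z → 3 * n + 3 + (y + H′ + 3 * γ + (y′ + H + z)) + 0 ≡
                  y + H′ + z + (y′ + H + (3 * (n + γ) + 3))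
          arith = solve-∀
          arith′ : ∀ q → 4 * (3 + q) + 5 + 0 + (1 + 2 * q) ≡ 3 * (2 * (3 + q)) + 0
          arith′ = solve-∀

        high-move : γ < 2 * x → Cover ((K ∷ T) ++ downFrom ℓ) (_∈ᵗ t)
        high-move γ< = top-move g desc
          (linear 0 (+-mono-≤ γ< (pair x≤M ≤-refl (≤-trans (<⇒≤ γ<) 2x≤K))) (arith K x γ (gain K))) next
          where
          arith : ∀ K x γ δ → K + 3 + (2 * x + (γ + δ)) + 0 ≡ δ + (suc γ + (K + 2 * x + 2))
          arith = solve-∀
          spent : ∀ {n′ γ} → n′ + γ ≡ size t → K + 3 ≤ γ → T ≡ [] → 3 * n′ + 3 ≤ budget ℓ
          spent {n′} {γ} n′≡ K≤ refl = linear 0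
            (+-mono-≤ (+-mono-≤ H≤N (*-monoʳ-≤ 3 K≤)) (≤-trans (≤-reflexive (cong (λ n → 3 * n + 3) n′≡)) le))
            (arith′ n′ γ K H (budget ℓ))
            where
            arith′ : ∀ n γ K H y → 3 * n + 3 + (3 * 1 + 3 * γ + (y + H + 3 * (1 * (K + 2)))) + 0 ≡
                     y + (H + 3 * (K + 3) + (3 * (n + γ) + 3))
            arith′ = solve-∀
          arith″ : ∀ n γ K H H′ y N →
            3 * n + 3 + (3 + H′ + 3 * γ + (y + H + 3 * (suc N * (K + 2)))) + 0 ≡
            y + H′ + 3 * (N * (K + 2)) + (H + 3 * (K + 3) + (3 * (n + γ) + 3))
          arith″ = solve-∀
          next : ∀ us {r vs} {t′ : Tree v} {γ} → K ∷ T ≡ us ++ r ∷ vs → size t′ + γ ≡ size t → K + 3 ≤ γ →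
            (∀ {s} → s ∈ us → s ≤ K) → (∀ {s} → s ∈ vs → 2 * s + 2 ≤ γ) → Descending (us ++ vs) →
            Cover ((us ++ vs) ++ downFrom ℓ) (_∈ᵗ t′)
          next [] {vs = vs} {t′} refl t≡ K≤γ us≤ below desc′ =
            cover-phase _ vs t′ ≤-refl ℓ≤a desc′ (spent t≡ K≤γ)
              (ranked-shift vs (λ s∈ → shift-bound t≡ (below s∈)) rk)
          next (_ ∷ us) {r} {vs} {t′} {γ} refl t≡ K≤γ us≤ below desc′ =
            cover-debt K 2a≤ f {q = suc q} {H ∸ 3} (us ++ vs) t′
              (≤-trans (≤-reflexive (trans (sym (+-suc q (length (us ++ vs)))) (cong (q +_) (sym len≡)))) len≤)
              ℓ≤a (≤-trans (m∸n≤m H 3) H≤)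
              (m≤n+o⇒m∸n≤o H 3 (≤-trans H≤N (≤-reflexive (trans (*-suc 3 _) (cong (λ N → 3 + 3 * N) len≡)))))
              desc′
              (≤-trans (+-monoʳ-≤ a (s≤s (≤-trans (n≤1+n _) (≤-reflexive (sym len≡))))) K≥)
              (linear 0 (+-mono-≤ (+-mono-≤ (m≤n+m∸n H 3) (*-monoʳ-≤ 3 K≤γ))
                  (≤-trans (≤-reflexive (cong (λ n → 3 * n + 3) t≡))
                    (subst (λ N → 3 * size t + 3 ≤ budget ℓ + H + 3 * (suc N * (K + 2))) len≡ le)))
                (arith″ (size t′) γ K H (H ∸ 3) (budget ℓ) (suc (length (us ++ vs)))))
              (delete-bound us t≡ (≤-trans (+-monoʳ-≤ K (n≤1+n 2)) K≤γ) (λ s∈ → us≤ (there s∈)) below rk)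
            where
            len≡ : length (us ++ r ∷ vs) ≡ suc (length (us ++ vs))
            len≡ = length-++-sucʳ us r vs

        move : Cover ((K ∷ T) ++ downFrom ℓ) (_∈ᵗ t)
        move with 2 * x ≤? γ
        ... | yes γ≥ = low-move γ≥
        ... | no γ≱  = high-move (≰⇒> γ≱)

    coverable-even : ∀ b → let a = suc b in (∀ {m} → m < a + a → Coverable m) → Coverable (a + a)
    coverable-even b IH t le = subst (λ L → Cover L (_∈ᵗ t)) (tops++downFrom a a)
      (cover-phase _ (tops a a) t ≤-refl ≤-refl (tops-descending a a) (λ ())
        (tops-ranked a 0 a λ i j _ eq →
          bound (≤-reflexive (+-suc a j)) (≤-trans le (initial i j eq))))
      where
      a = suc b
      4a<6a : 4 * a < 3 * (a + a)
      4a<6a = linear (1 + 2 * b) (z≤n {0}) (arith b)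
        where
        arith : ∀ b → suc (4 * suc b) + 0 + (1 + 2 * b) ≡ 3 * (suc b + suc b) + 0
        arith = solve-∀
      open Phase (a + a) a IH (s≤s z≤n) 4a<6a
      initial : ∀ {a} i j → i + suc j ≡ a →
        budget (a + a) ≤ budget a + 3 * (i * (2 * (a + j) + 2) + suc j * (a + j + 2))
      initial i j refl = linear (3 * (i * j)) (z≤n {0}) (arith i j)
        where
        arith : ∀ i j → let a = i + suc j in
          (a + a) * (2 * (a + a) + 3) + 0 + 3 * (i * j) ≡
          a * (2 * a + 3) + 3 * (i * (2 * (a + j) + 2) + suc j * (a + j + 2)) + 0
        arith = solve-∀

    coverable-odd : ∀ b → let c = 4 + b in (∀ {m} → m < c + suc c → Coverable m) → Coverable (c + suc c)
    coverable-odd b IH t le = subst (λ L → Cover L (_∈ᵗ t)) (tops++downFrom a c)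
      (cover-debt K (≤-reflexive (arith₁ b)) _ {q = 2 + b} {c} T t ≤-refl ≤-refl
        (linear (b * b + 3 * b) (z≤n {0}) (arith₂ b))
        (≤-trans (m≤m+n c (2 * c)) (*-monoʳ-≤ 3 (s≤s (≤-reflexive (sym len≡)))))
        (tops-descending a c)
        (≤-reflexive (trans (cong (λ N → a + suc N) len≡) (+-suc a (3 + b))))
        (≤-trans le (≤-reflexive (trans (arith₃ b)
          (cong (λ N → budget a + c + 3 * (suc N * (K + 2))) (sym len≡)))))
        (tops-ranked a 1 (3 + b) λ where
          (suc i) j _ eq → bound (≤-reflexive (+-suc a j)) (≤-trans le (initial i j eq))))
      where
      c = 4 + b
      a = suc c
      K = a + (3 + b)
      T = tops a (3 + b)
      len≡ : length T ≡ 3 + b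
      len≡ = length-applyDownFrom (a +_) (3 + b)
      4a<3k : 4 * a < 3 * (c + a)
      4a<3k = linear (6 + 2 * b) (z≤n {0}) (arith b)
        where
        arith : ∀ b → suc (4 * (5 + b)) + 0 + (6 + 2 * b) ≡ 3 * (4 + b + (5 + b)) + 0
        arith = solve-∀
      open Phase (c + a) a IH (s≤s z≤n) 4a<3k
      arith₁ : ∀ b → 2 * (5 + b) ≡ 5 + b + (3 + b) + 2
      arith₁ = solve-∀
      arith₂ : ∀ b → 4 + b + 0 + (b * b + 3 * b) ≡ (2 + b) * (2 + b) + 0
      arith₂ = solve-∀
      arith₃ : ∀ b → (4 + b + (5 + b)) * (2 * (4 + b + (5 + b)) + 3) ≡
        (5 + b) * (2 * (5 + b) + 3) + (4 + b) + 3 * ((4 + b) * (5 + b + (3 + b) + 2))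
      arith₃ = solve-∀
      initial : ∀ {c} i j → suc i + suc j ≡ c → budget (c + suc c) ≤
        budget (suc c) + 3 * (suc i * (2 * (suc c + j) + 2) + suc j * (suc c + j + 2))
      initial i j refl = linear (3 * (i * j) + 2 * i + 2 * j + 1) (z≤n {0}) (arith i j)
        where
        arith : ∀ i j → let c = suc i + suc j in
          (c + suc c) * (2 * (c + suc c) + 3) + 0 + (3 * (i * j) + 2 * i + 2 * j + 1) ≡
          suc c * (2 * suc c + 3) +
            3 * (suc i * (2 * (suc c + j) + 2) + suc j * (suc c + j + 2)) + 0
        arith = solve-∀

    round-down : ∀ n q → 3 * n + 3 ≤ 2 + 3 * q → 3 * n + 3 ≤ 3 * q
    round-down n q le = ≤-trans (≤-reflexive (arith n))
      (*-monoʳ-≤ 3 (div₃ (suc n) q (≤-trans (≤-reflexive (sym (arith n))) le)))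
      where
      arith : ∀ n → 3 * n + 3 ≡ 3 * suc n
      arith = solve-∀

    coverable₁ : Coverable 1
    coverable₁ t le = contradiction
      (≤-trans (+-monoˡ-≤ 3 (*-monoʳ-≤ 3 (≤-trans (s≤s z≤n) (height<size t)))) le) 1+n≰n

    coverable₃ : Coverable 3
    coverable₃ t le with gains t 2
    ... | inj₁ sw = swallow sw
    ... | inj₂ g with Gains.removes g {0} z≤n
    ...   | t′ , t′≡ , c , cov = cover-insert (2 ∷ 1 ∷ []) c cov
      (cover-tops _ (2 ∷ 1 ∷ []) t′ ≤-refl (λ ()) (tops-descending 1 2)
        (topBound (≤-trans t′≤7 (n≤1+n 7)) , topBound t′≤7 , tt))
      where
      t≤8 : size t ≤ 8
      t≤8 = div₃ (size t) 8 (≤-trans (+-cancelʳ-≤ 3 _ 24 le) (m≤n+m 24 2))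
      t′≤7 : size t′ ≤ 7
      t′≤7 = +-cancelʳ-≤ 1 _ 7 (≤-trans (+-monoʳ-≤ (size t′) (Gains.large g {0} z≤n))
        (≤-trans (≤-reflexive t′≡) t≤8))

    coverable₅ : (∀ {m} → m < 5 → Coverable m) → Coverable 5
    coverable₅ IH t le = cover-phase _ (tops 3 2) t ≤-refl ≤-refl (tops-descending 3 2) (λ ())
      (bound (≤ᵇ⇒≤ _ _ tt) (≤-trans le′ (≤ᵇ⇒≤ _ _ tt)) ,
       bound (≤ᵇ⇒≤ _ _ tt) (≤-trans le′ (≤ᵇ⇒≤ _ _ tt)) , tt)
      where
      open Phase 5 3 IH (≤ᵇ⇒≤ _ _ tt) (≤ᵇ⇒≤ _ _ tt)
      le′ = round-down (size t) 21 le

    coverable₇ : (∀ {m} → m < 7 → Coverable m) → Coverable 7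
    coverable₇ IH t le = cover-debt 6 (≤ᵇ⇒≤ _ _ tt) _ {q = 1} {1} (tops 4 2) t ≤-refl ≤-refl ≤-refl
      (s≤s z≤n) (tops-descending 4 3) ≤-refl le′
      (bound (≤ᵇ⇒≤ _ _ tt) (≤-trans le′ (≤ᵇ⇒≤ _ _ tt)) ,
       bound (≤ᵇ⇒≤ _ _ tt) (≤-trans le′ (≤ᵇ⇒≤ _ _ tt)) , tt)
      where
      open Phase 7 4 IH (≤ᵇ⇒≤ _ _ tt) (≤ᵇ⇒≤ _ _ tt)
      le′ = round-down (size t) 39 le

    coverable : ∀ k → Coverable k
    coverable = <-rec Coverable λ k IH → by-parity k (parity k) λ {m} → IH {m}
      where
      parity : ∀ k → ∃[ a ] (k ≡ a + a ⊎ k ≡ suc (a + a))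
      parity zero    = 0 , inj₁ refl
      parity (suc k) with parity k
      ... | a , inj₁ eq = a , inj₂ (cong suc eq)
      ... | a , inj₂ eq = suc a , inj₁ (trans (cong suc eq) (cong suc (sym (+-suc a a))))
      by-parity : ∀ k → ∃[ a ] (k ≡ a + a ⊎ k ≡ suc (a + a)) → (∀ {m} → m < k → Coverable m) → Coverable k
      by-parity _ (0     , inj₁ refl) IH t le = contradiction (≤-trans (m≤n+m 3 (3 * size t)) le) λ ()
      by-parity _ (suc b , inj₁ refl) IH = coverable-even b IH
      by-parity _ (0     , inj₂ refl) IH = coverable₁
      by-parity _ (1     , inj₂ refl) IH = coverable₃
      by-parity _ (2     , inj₂ refl) IH = coverable₅ IH
      by-parity _ (3     , inj₂ refl) IH = coverable₇ IH
      by-parity _ (suc (suc (suc (suc b))) , inj₂ eq) IH =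
        subst Coverable (sym eq′) (coverable-odd b (λ m< → IH (≤-trans m< (≤-reflexive (sym eq′)))))
        where
        eq′ = trans eq (sym (+-suc (4 + b) (4 + b)))

module BurningTime where

  open TreeGains
  open CoveringGame
  open import Data.Fin.Base using (Fin; zero)
  open import Data.Fin.Properties using (any?; all?; ¬∀⟶∃¬)
  open import Data.Fin.Subset using (Subset; ⁅_⁆; _∪_; _∈_; _∉_; _⊆_; ∣_∣) renaming (⊥ to ∅)
  open import Data.Fin.Subset.Properties using (_∈?_; x∈⁅x⁆; x∈⁅y⁆⇒x≡y; ∣⁅x⁆∣≡1; ∣p∣≤n; p⊆p∪q; q⊆p∪q; x∈p∪q⁻; p⊂q⇒∣p∣<∣q∣)
  open import Data.List.Base using (downFrom)
  open import Data.Nat.Base using (zero; suc; _+_; _*_; _≤_; _<_; s≤s)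
  open import Data.Nat.Properties
  open import Data.Product using (∃-syntax; Σ-syntax; _×_; _,_)
  open import Data.Sum using (_⊎_; inj₁; inj₂; map₁)
  open import Data.Vec.Properties using (lookup∘tabulate; lookup⇒[]=)
  open import Relation.Binary.Construct.Closure.ReflexiveTransitive using (Star; ε; _◅_)
  open import Relation.Binary.PropositionalEquality using (_≡_; refl; sym; trans; cong; subst)
  open import Relation.Nullary using (yes; no; contradiction)
  open import Relation.Nullary.Decidable using (dec-true; _×-dec_)

  module SpanningTree {n} (G : Graph n) where
    open Graph G
    open Trees G

    attach : ∀ {v w u} (t : Tree v) → w ∈ᵗ t → w ~ u → Tree v
    attach (leaf w)      root      e = graft e (leaf w) (leaf _)
    attach (graft f s t) (left p)  e = graft f (attach s p e) t
    attach (graft f s t) (right p) e = graft f s (attach t p e)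

    size-attach : ∀ {v w u} (t : Tree v) (p : w ∈ᵗ t) (e : w ~ u) → size (attach t p e) ≡ suc (size t)
    size-attach (leaf w)      root      e = refl
    size-attach (graft f s t) (left p)  e = cong (_+ size t) (size-attach s p e)
    size-attach (graft f s t) (right p) e =
      trans (cong (λ m → size s + m) (size-attach t p e)) (+-suc (size s) (size t))

    ∈-attach-new : ∀ {v w u} (t : Tree v) (p : w ∈ᵗ t) (e : w ~ u) → u ∈ᵗ attach t p e
    ∈-attach-new (leaf w)      root      e = right root
    ∈-attach-new (graft f s t) (left p)  e = left (∈-attach-new s p e)
    ∈-attach-new (graft f s t) (right p) e = right (∈-attach-new t p e)

    ∈-attach-old : ∀ {x v w u} (t : Tree v) (p : w ∈ᵗ t) (e : w ~ u) → x ∈ᵗ t → x ∈ᵗ attach t p e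
    ∈-attach-old (leaf w)      root      e q         = left q
    ∈-attach-old (graft f s t) (left p)  e (left q)  = left (∈-attach-old s p e q)
    ∈-attach-old (graft f s t) (left p)  e (right q) = right q
    ∈-attach-old (graft f s t) (right p) e (left q)  = left q
    ∈-attach-old (graft f s t) (right p) e (right q) = right (∈-attach-old t p e q)

    exit-edge : ∀ {v u} (S : Subset n) → v ∈ S → u ∉ S → Star _~_ v u →
                ∃[ w ] ∃[ x ] w ∈ S × x ∉ S × w ~ x
    exit-edge S v∈S u∉S ε = contradiction v∈S u∉S
    exit-edge S v∈S u∉S (_◅_ {j = w} e es) with w ∈? S
    ... | yes w∈S = exit-edge S w∈S u∉S es
    ... | no w∉S  = _ , w , v∈S , w∉S , e

    Spanning : Fin n → Set
    Spanning v = Σ[ t ∈ Tree v ] size t ≤ n × (∀ x → x ∈ᵗ t)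

    grow : Connected G → ∀ f {v} S (t : Tree v) → n ≤ f + ∣ S ∣ → v ∈ S → size t ≤ ∣ S ∣ →
           (∀ {x} → x ∈ S → x ∈ᵗ t) → Spanning v
    grow conn f S t n≤ v∈S size≤ S⊆t with all? (_∈? S)
    ... | yes full = t , ≤-trans size≤ (∣p∣≤n S) , λ x → S⊆t (full x)
    ... | no ¬full with ¬∀⟶∃¬ n (_∈ S) (_∈? S) ¬full
    ...   | u , u∉S with exit-edge S v∈S u∉S (conn _ u)
    ...     | w , x , w∈S , x∉S , e = extend f n≤
      where
      S′ = S ∪ ⁅ x ⁆
      ∣S∣<∣S′∣ : ∣ S ∣ < ∣ S′ ∣
      ∣S∣<∣S′∣ = p⊂q⇒∣p∣<∣q∣ (p⊆p∪q ⁅ x ⁆ , x , q⊆p∪q S ⁅ x ⁆ (x∈⁅x⁆ x) , x∉S)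
      t′ = attach t (S⊆t w∈S) e
      S′⊆t′ : ∀ {y} → y ∈ S′ → y ∈ᵗ t′
      S′⊆t′ y∈ with x∈p∪q⁻ S ⁅ x ⁆ y∈
      ... | inj₁ y∈S = ∈-attach-old t (S⊆t w∈S) e (S⊆t y∈S)
      ... | inj₂ y∈x with x∈⁅y⁆⇒x≡y x y∈x
      ...   | refl = ∈-attach-new t (S⊆t w∈S) e
      extend : ∀ f → n ≤ f + ∣ S ∣ → Spanning _
      extend zero    n≤ = contradiction (≤-trans ∣S∣<∣S′∣ (≤-trans (∣p∣≤n S′) n≤)) 1+n≰n
      extend (suc f) n≤ = grow conn f S′ t′
        (≤-trans n≤ (≤-trans (≤-reflexive (sym (+-suc f ∣ S ∣))) (+-monoʳ-≤ f ∣S∣<∣S′∣)))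
        (p⊆p∪q ⁅ x ⁆ v∈S)
        (≤-trans (≤-reflexive (size-attach t (S⊆t w∈S) e)) (≤-trans (s≤s size≤) ∣S∣<∣S′∣))
        S′⊆t′

    spanning-tree : Connected G → ∀ v → Spanning v
    spanning-tree conn v = grow conn n ⁅ v ⁆ (leaf v) (m≤m+n n _) (x∈⁅x⁆ v)
      (≤-reflexive (sym (∣⁅x⁆∣≡1 v)))
      (λ x∈ → subst (_∈ᵗ leaf v) (sym (x∈⁅y⁆⇒x≡y v x∈)) root)

  module Fire {n} (G : Graph n) where
    open Graph G
    open Trees G
    open Burning G

    ∈-spread : ∀ {S u v} → u ∈ S → u ~ v → v ∈ spread S
    ∈-spread {S} {u} {v} u∈S e = q⊆p∪q S (neighbours S) (lookup⇒[]= v (neighbours S)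
      (trans (lookup∘tabulate _ v) (dec-true (any? λ w → (w ∈? S) ×-dec (w ~? v)) (u , u∈S , e))))

    some-round : ∀ S → ∃[ T ] Round S T × spread S ⊆ T
    some-round S with all? (_∈? S)
    ... | yes full = _ , nothing full , λ x∈ → x∈
    ... | no ¬full with ¬∀⟶∃¬ n (_∈ S) (_∈? S) ¬full
    ...   | x , x∉S = _ , ignite x x∉S , p⊆p∪q ⁅ x ⁆

    round-at : ∀ S c → ∃[ T ] Round S T × spread S ⊆ T × c ∈ T
    round-at S c with c ∈? S
    ... | no c∉S  = _ , ignite c c∉S , p⊆p∪q ⁅ c ⁆ , q⊆p∪q (spread S) ⁅ c ⁆ (x∈⁅x⁆ c)
    ... | yes c∈S with some-round S
    ...   | T , rd , S⊆T = T , rd , S⊆T , S⊆T (p⊆p∪q (neighbours S) c∈S)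

    burn : ∀ k S {P} → Cover (downFrom k) P →
           (∀ v → (∃[ u ] u ∈ S × Within k u v) ⊎ P v) → BurnsFrom S k
    burn zero S (done empty) reach = S , [] , λ v → burned v (reach v)
      where
      burned : ∀ v → _ → v ∈ S
      burned v (inj₁ (_ , u∈S , here)) = u∈S
      burned v (inj₂ p)                = contradiction p (empty v)
    burn (suc k) S cov reach = first cov reach
      where
      later : ∀ {T} → Round S T → BurnsFrom T k → BurnsFrom S (suc k)
      later rd (U , rds , full) = U , rd ∷ rds , full
      spreads : ∀ {T v} → spread S ⊆ T → ∃[ u ] u ∈ S × Within (suc k) u v → ∃[ u ] u ∈ T × Within k u v
      spreads S⊆T (u , u∈S , here)      = u , S⊆T (p⊆p∪q (neighbours S) u∈S) , here
      spreads S⊆T (u , u∈S , step e wn) = _ , S⊆T (∈-spread u∈S e) , wn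
      first : ∀ {P} → Cover (downFrom (suc k)) P →
              (∀ v → (∃[ u ] u ∈ S × Within (suc k) u v) ⊎ P v) → BurnsFrom S (suc k)
      first {P} (done empty) reach with some-round S
      ... | T , rd , S⊆T = later rd (burn k T {P} (done empty)
        (λ v → map₁ (spreads S⊆T) (reach v)))
      first (ball {Q = Q} c f cov) reach with round-at S c
      ... | T , rd , S⊆T , c∈T = later rd (burn k T cov (λ v → advance v (reach v)))
        where
        advance : ∀ v → _ → (∃[ u ] u ∈ T × Within k u v) ⊎ Q v
        advance v (inj₁ near) = inj₁ (spreads S⊆T near)
        advance v (inj₂ p)    = map₁ (λ wn → c , c∈T , wn) (f p)

  burns-in : ∀ n (G : Graph n) → Connected G → ∀ k → 3 * n + 3 ≤ budget k → Burning.BurnsIn G k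
  burns-in zero    G conn k le = Fire.burn G k ∅ {λ _ → Fin 0} (Trees.done λ ()) (λ ())
  burns-in (suc n) G conn k le with SpanningTree.spanning-tree G conn zero
  ... | t , size≤ , all∈ = Fire.burn G k ∅
    (Game.coverable G k t (≤-trans (+-monoˡ-≤ 3 (*-monoʳ-≤ 3 size≤)) le)) (λ v → inj₂ (all∈ v))

module Ceiling where

  open TreeGains
  open CoveringGame
  open BurningTime
  open import Data.Integer.Base as ℤ using (ℤ; +_; -[1+_]; -_)
  import Data.Integer.Properties as ℤ
  open import Data.Nat.Base using (ℕ; _+_; _*_; _≤_; z≤n; s≤s; NonZero; >-nonZero)
  open import Data.Nat.Properties
  open import Data.Nat.Tactic.RingSolver using (solve-∀)
  open import Data.Product using (∃-syntax; _×_; _,_; proj₂)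
  open import Data.Rational.Unnormalised.Base as ℚᵘ using (mkℚᵘ; *≤*)
  open import Relation.Binary.PropositionalEquality using (_≡_; refl; sym; cong; subst; subst₂; module ≡-Reasoning)

  Enough : ℕ → ℕ → Set
  Enough n k = 24 * n + 33 ≤ (4 * k + 3) * (4 * k + 3)

  ceiling-budget : ∀ n k → Enough n k → 3 * n + 3 ≤ budget k
  ceiling-budget n k le = *-cancelˡ-≤ 8 (linear 0 le (arith n k))
    where
    arith : ∀ n k → 8 * (3 * n + 3) + (4 * k + 3) * (4 * k + 3) + 0 ≡
            8 * (k * (2 * k + 3)) + (24 * n + 33)
    arith = solve-∀

  -- The numerator to which j / 1 * 4 - (- 3) computes; its denominator is 1.
  numerator : ℤ → ℤ
  numerator j = j ℤ.* + 4 ℤ.* + 1 ℤ.+ + 3 ℤ.* + 1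

  numerator-+ : ∀ k → numerator (+ k) ≡ + (4 * k + 3)
  numerator-+ k = begin
    + k ℤ.* + 4 ℤ.* + 1 ℤ.+ + 3  ≡⟨ cong (ℤ._+ + 3) (ℤ.*-identityʳ (+ k ℤ.* + 4)) ⟩
    + k ℤ.* + 4 ℤ.+ + 3          ≡⟨ cong (ℤ._+ + 3) (sym (ℤ.pos-* k 4)) ⟩
    + (k * 4 + 3)                ≡⟨ cong (λ m → + (m + 3)) (*-comm k 4) ⟩
    + (4 * k + 3)                ∎
    where open ≡-Reasoning

  integral-≤⁺ : ∀ {i j} → i ℤ.≤ j → mkℚᵘ i 0 ℚᵘ.≤ mkℚᵘ j 0
  integral-≤⁺ {i} {j} i≤j = *≤* (subst₂ ℤ._≤_ (sym (ℤ.*-identityʳ i)) (sym (ℤ.*-identityʳ j)) i≤j)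

  integral-≤⁻ : ∀ {i j} → mkℚᵘ i 0 ℚᵘ.≤ mkℚᵘ j 0 → i ℤ.≤ j
  integral-≤⁻ {i} {j} (*≤* le) = subst₂ ℤ._≤_ (ℤ.*-identityʳ i) (ℤ.*-identityʳ j) le

  cut-intro : ∀ n k → Enough n k →
              ((- (+ 3) ⊕ √ (24 * n + 33)) ÷ 4) (mkℚᵘ (+ k) 0)
  cut-intro n k le = subst (λ z → (√ (24 * n + 33)) (mkℚᵘ z 0)) (sym (numerator-+ k))
    ( integral-≤⁺ (ℤ.+≤+ z≤n)
    , integral-≤⁺ (ℤ.≤-trans (ℤ.+≤+ le) (ℤ.≤-reflexive (ℤ.pos-* (4 * k + 3) (4 * k + 3)))))

  cut-elim : ∀ n j → ((- (+ 3) ⊕ √ (24 * n + 33)) ÷ 4) (mkℚᵘ j 0) →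
             ∃[ k ] j ≡ + k × Enough n k
  cut-elim n (+ k) x≤k
    with subst (λ z → (√ (24 * n + 33)) (mkℚᵘ z 0)) (numerator-+ k) x≤k
  ... | _ , le = k , refl , ℤ.drop‿+≤+
    (ℤ.≤-trans (integral-≤⁻ le) (ℤ.≤-reflexive (sym (ℤ.pos-* (4 * k + 3) (4 * k + 3)))))
  cut-elim n -[1+ i ] (*≤* () , _)

  least-enough : ∀ n → ∃[ k ] Enough n k × (∀ j → Enough n j → k ≤ j)
  least-enough n = least (Enough n) (λ _ → _ ≤? _) (6 * n + 8) (begin
    24 * n + 33                ≤⟨ linear 2 (z≤n {0}) (arith n) ⟩
    m                          ≤⟨ m≤m*n m m {{m≢0}} ⟩
    m * m                      ∎)
    where
    open ≤-Reasoning
    m = 4 * (6 * n + 8) + 3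
    m≢0 : NonZero m
    m≢0 = >-nonZero (≤-trans (s≤s z≤n) (m≤n+m 3 (4 * (6 * n + 8))))
    arith : ∀ n → 24 * n + 33 + 0 + 2 ≡ 4 * (6 * n + 8) + 3 + 0
    arith = solve-∀

  least-enough-ceiling : ∀ n k → Enough n k → (∀ j → Enough n j → k ≤ j) →
                         (+ k) IsCeilingOf ((- (+ 3) ⊕ √ (24 * n + 33)) ÷ 4)
  least-enough-ceiling n k enough minimal = cut-intro n k enough , smallest
    where
    smallest : ∀ j → ((- (+ 3) ⊕ √ (24 * n + 33)) ÷ 4) (mkℚᵘ j 0) → + k ℤ.≤ j
    smallest j x≤j with cut-elim n j x≤j
    ... | i , refl , enough′ = ℤ.+≤+ (minimal i enough′)

  burningNumber≤ : ∀ {n} (G : Graph n) → Connected G → ∀ k → Enough n k → burningNumber G ≤ k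
  burningNumber≤ {n} G conn k enough = proj₂ (proj₂ (Burning.minimumRounds G)) k
    (burns-in n G conn k (ceiling-budget n k enough))

open import Data.Integer.Base using (+_; -_; _≤_; +≤+)
open import Data.Nat.Base using (ℕ; _+_; _*_)
open import Data.Product using (∃-syntax; _×_; _,_)
open Ceiling using (least-enough; least-enough-ceiling; burningNumber≤)

theorem1 : ∀ (n : ℕ) (G : Graph n) → Connected G →
    ∃[ k ] k IsCeilingOf ((- (+ 3) ⊕ √ (24 * n + 33)) ÷ 4) × + burningNumber G ≤ k
theorem1 n G conn =
  let k , enough , minimal = least-enough n
  in + k , least-enough-ceiling n k enough minimal , +≤+ (burningNumber≤ G conn k enough)
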